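{- A boolean combination of conditional formulas (formulas $A\mathrel{|\!\sim}B$ with $A,B$ propositional) is satisfiable in a loop-cumulative model $\mathcal{M}=\langle S,\mathcal{W},l,<,V\rangle$ if and only if it is satisfiable in a CL-preferential model $\mathcal{M}'=\langle\mathcal{W}',R,<',V'\rangle$.
   Context: Propositional formulas ($A,B,\dots$) are built from a set $\mathit{ATM}$ of propositional variables with the boolean connectives. **Loop-cumulative model** $\mathcal{M}=\langle S,\mathcal{W},l,<,V\rangle$: $S$ is a set of states; $\mathcal{W}$ a set of possible worlds; $l:S\to\mathrm{pow}(\mathcal{W})$ labels every state with a non-empty set of worlds; $<$ is an irreflexive and transitive relation on $S$; $V:\mathcal{W}\to\mathrm{pow}(\mathit{ATM})$ gives the atoms true at each world. For $A$ propositional and $s\in S$, $\mathcal{M},s\mid\!\equiv A$ iff $\mathcal{M},w\models A$ (classical evaluation at $w$ via $V$) for all $w\in l(s)$. $Min_<(A)$ is the set of $<$-minimal states among the states $s$ with $\mathcal{M},s\mid\!\equiv A$. $\mathcal{M},s\mid\!\equiv A\mathrel{|\!\sim}B$ iff $\mathcal{M},s'\mid\!\equiv B$ for all $s'\in Min_<(A)$; $\mid\!\equiv$ extends to boolean combinations of conditionals in the standard (classical) way. Smoothness condition (part of the definition): for every propositional $A$ and state $s$, if $\mathcal{M},s\mid\!\equiv A$ then $s\in Min_<(A)$ or there is $s'\in Min_<(A)$ with $s'<s$. A boolean combination of conditionals is satisfiable in $\mathcal{M}$ if it holds ($\mid\!\equiv$) at some state. **CL-preferential model** $\mathcal{M}=\langle\mathcal{W},R,<,V\rangle$: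 $\mathcal{W}$ is a non-empty set of worlds; $R$ is a serial relation on $\mathcal{W}$; $<$ is an irreflexive and transitive relation on $\mathcal{W}$; $V:\mathcal{W}\to\mathrm{pow}(\mathit{ATM})$. Boolean combinations are evaluated classically at worlds. For $A$ propositional, $\mathcal{M},w\models LA$ iff $\mathcal{M},w'\models A$ for all $w'$ with $wRw'$. $Min_<(LA)=\{w\mid\mathcal{M},w\models LA$ and for all $w'<w$, $\mathcal{M},w'\not\models LA\}$. $\mathcal{M},w\models A\mathrel{|\!\sim}B$ iff $\mathcal{M},w'\models LB$ for all $w'\in Min_<(LA)$. Smoothness condition (part of the definition): for every propositional $A$ and world $w$, if $\mathcal{M},w\models LA$ then $w\in Min_<(LA)$ or there is $w'\in Min_<(LA)$ with $w'<w$. A formula is satisfiable in $\mathcal{M}$ if it is true at some world. -}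

module Defs where

open import Level using (Level; _⊔_; suc; lift; lower)
open import Data.Empty.Polymorphic using (⊥)
open import Data.Unit.Polymorphic using (⊤; tt)
open import Data.Product using (_×_; _,_; proj₁; proj₂; ∃; ∃-syntax)
open import Data.Sum using (_⊎_)
open import Relation.Nullary.Negation using (¬_; Stable; negated-stable)
open import Relation.Unary using (Pred; _∈_; Satisfiable)
open import Relation.Binary using (Rel; Irreflexive; Transitive)
open import Relation.Binary.PropositionalEquality using (_≡_)

private
  variable
    a ℓ p r : Level

infix  30 ¬′_
infixr 25 _∧′_
infixr 24 _∨′_
infixr 23 _⇒′_
infix  20 _|~_

data BooleanCombination (X : Set a) : Set a where
  atom           : X → BooleanCombination X
  ⊤′ ⊥′          : BooleanCombination X
  ¬′_            : BooleanCombination X → BooleanCombination X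
  _∧′_ _∨′_ _⇒′_ : BooleanCombination X → BooleanCombination X → BooleanCombination X

Formula : Set a → Set a
Formula ATM = BooleanCombination ATM

data Conditional (ATM : Set a) : Set a where
  _|~_ : Formula ATM → Formula ATM → Conditional ATM

-- Boolean evaluation must be classical although the metatheory is constructive
-- and atoms need not be decidable. Hence the double negations at atoms and
-- disjunctions, which classically can be erased: every truth value is then
-- stable (eval-stable), so that all classical laws hold.
eval : {X : Set a} → (X → Set ℓ) → BooleanCombination X → Set ℓ
eval ρ (atom x) = ¬ ¬ ρ x
eval ρ ⊤′       = ⊤
eval ρ ⊥′       = ⊥
eval ρ (¬′ φ)   = ¬ eval ρ φ
eval ρ (φ ∧′ ψ) = eval ρ φ × eval ρ ψ
eval ρ (φ ∨′ ψ) = ¬ ¬ (eval ρ φ ⊎ eval ρ ψ)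
eval ρ (φ ⇒′ ψ) = eval ρ φ → eval ρ ψ

eval-stable : {X : Set a} (ρ : X → Set ℓ) (φ : BooleanCombination X) → Stable (eval ρ φ)
eval-stable ρ (atom x) = negated-stable
eval-stable ρ ⊤′       = λ _ → tt
eval-stable ρ ⊥′       = λ nn → lift (nn lower)
eval-stable ρ (¬′ φ)   = negated-stable
eval-stable ρ (φ ∧′ ψ) = λ nn →
  eval-stable ρ φ (λ n → nn (λ q → n (proj₁ q))) ,
  eval-stable ρ ψ (λ n → nn (λ q → n (proj₂ q)))
eval-stable ρ (φ ∨′ ψ) = negated-stable
eval-stable ρ (φ ⇒′ ψ) = λ nn x → eval-stable ρ ψ (λ n → nn (λ f → n (f x)))

Min : {X : Set a} → Rel X r → Pred X p → Pred X (a ⊔ r ⊔ p)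
Min _<_ P x = x ∈ P × (∀ y → y < x → ¬ (y ∈ P))

Smooth : {X : Set a} → Rel X r → Pred X p → Set (a ⊔ r ⊔ p)
Smooth _<_ P = ∀ x → x ∈ P → x ∈ Min _<_ P ⊎ (∃[ y ] y ∈ Min _<_ P × y < x)

record LoopCumulativeModel (ATM : Set a) (ℓ : Level) : Set (a ⊔ suc ℓ) where
  infix 4 _<_ _⊨_ _∣≡_ _∣≡ᶜ_
  field
    S          : Set ℓ
    W          : Set ℓ
    l          : S → Pred W ℓ
    l-nonEmpty : ∀ s → Satisfiable (l s)
    _<_        : Rel S ℓ
    <-irrefl   : Irreflexive _≡_ _<_
    <-trans    : Transitive _<_
    V          : W → Pred ATM ℓ

  _⊨_ : W → Formula ATM → Set ℓ
  w ⊨ A = eval (V w) A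

  _∣≡_ : S → Formula ATM → Set ℓ
  s ∣≡ A = ∀ w → w ∈ l s → w ⊨ A

  field
    smooth : ∀ (A : Formula ATM) → Smooth _<_ (_∣≡ A)

  ConditionalAt : S → Conditional ATM → Set ℓ
  ConditionalAt s (A |~ B) = ∀ s′ → s′ ∈ Min _<_ (_∣≡ A) → s′ ∣≡ B

  _∣≡ᶜ_ : S → BooleanCombination (Conditional ATM) → Set ℓ
  s ∣≡ᶜ φ = eval (ConditionalAt s) φ

record CLPreferentialModel (ATM : Set a) (ℓ : Level) : Set (a ⊔ suc ℓ) where
  infix 4 _<_ _⊨_ _⊨L_ _⊨ᶜ_
  field
    W          : Set ℓ
    W-nonEmpty : W
    R          : Rel W ℓ
    R-serial   : ∀ w → ∃[ w′ ] R w w′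
    _<_        : Rel W ℓ
    <-irrefl   : Irreflexive _≡_ _<_
    <-trans    : Transitive _<_
    V          : W → Pred ATM ℓ

  _⊨_ : W → Formula ATM → Set ℓ
  w ⊨ A = eval (V w) A

  _⊨L_ : W → Formula ATM → Set ℓ
  w ⊨L A = ∀ w′ → R w w′ → w′ ⊨ A

  field
    smooth : ∀ (A : Formula ATM) → Smooth _<_ (_⊨L A)

  ConditionalAt : W → Conditional ATM → Set ℓ
  ConditionalAt w (A |~ B) = ∀ w′ → w′ ∈ Min _<_ (_⊨L A) → w′ ⊨L B

  _⊨ᶜ_ : W → BooleanCombination (Conditional ATM) → Set ℓ
  w ⊨ᶜ φ = eval (ConditionalAt w) φ

LoopCumulativeSatisfiable : {ATM : Set a} (ℓ : Level) →
                            BooleanCombination (Conditional ATM) → Set (a ⊔ suc ℓ)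
LoopCumulativeSatisfiable {ATM = ATM} ℓ φ =
  ∃ λ (M : LoopCumulativeModel ATM ℓ) →
    let open LoopCumulativeModel M in ∃[ s ] s ∣≡ᶜ φ

CLPreferentialSatisfiable : {ATM : Set a} (ℓ : Level) →
                            BooleanCombination (Conditional ATM) → Set (a ⊔ suc ℓ)
CLPreferentialSatisfiable {ATM = ATM} ℓ φ =
  ∃ λ (M : CLPreferentialModel ATM ℓ) →
    let open CLPreferentialModel M in ∃[ w ] w ⊨ᶜ φ

{-# OPTIONS --safe #-}
module Submission where

-- Each kind of model is turned into one of the other kind, labels of states
-- corresponding to sets of accessible worlds.
--
-- From a CL-preferential model, take every world w as a state labelled with
-- the set of worlds that R relates to w (non-empty since R is serial). Then
-- "s satisfies A" unfolds to "LA holds at s", so nothing else changes.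
--
-- From a loop-cumulative model, take as worlds the pairs of a state s and a
-- world w in l s. The order compares the states, the valuation is read off at
-- w, and R relates two pairs exactly when they have the same state. R is serial
-- because it is reflexive, and LA holds at (s , w) exactly when s satisfies A
-- (labelling-⊨L). As labels are non-empty, every state occurs in some pair, so
-- minimality, smoothness and the truth of conditionals depend only on the
-- state and agree with those of the original model (Min-pair⇔, conditional⇔).
--
-- In both directions the conditionals keep their truth values, hence so do
-- their boolean combinations (eval-cong).

open import Defs
open import Level using (Level)
open import Data.Product using (_,_; proj₁; ∃-syntax)
open import Data.Sum using (inj₁; inj₂)
import Data.Sum as Sum
open import Function.Base using (id)
open import Function.Bundles using (_⇔_; mk⇔; Equivalence)
open import Relation.Binary using (Rel)
open import Relation.Binary.PropositionalEquality using (_≡_; refl; cong)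
open import Relation.Nullary.Negation using (contraposition; ¬¬-map)
open import Relation.Unary using (_∈_)

open Equivalence using (to; from)

private
  variable
    a ℓ : Level

eval-cong : {X : Set a} {ρ σ : X → Set ℓ} → (∀ x → ρ x ⇔ σ x) →
            ∀ φ → eval ρ φ ⇔ eval σ φ
eval-cong e (atom x) = mk⇔ (¬¬-map (to (e x))) (¬¬-map (from (e x)))
eval-cong e ⊤′       = mk⇔ id id
eval-cong e ⊥′       = mk⇔ id id
eval-cong e (¬′ φ)   = mk⇔ (contraposition (from ih)) (contraposition (to ih))
  where ih = eval-cong e φ
eval-cong e (φ ∧′ ψ) = mk⇔ (λ (p , q) → to ih₁ p , to ih₂ q)
                           (λ (p , q) → from ih₁ p , from ih₂ q)
  where ih₁ = eval-cong e φ
        ih₂ = eval-cong e ψ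
eval-cong e (φ ∨′ ψ) = mk⇔ (¬¬-map (Sum.map (to ih₁) (to ih₂)))
                           (¬¬-map (Sum.map (from ih₁) (from ih₂)))
  where ih₁ = eval-cong e φ
        ih₂ = eval-cong e ψ
eval-cong e (φ ⇒′ ψ) = mk⇔ (λ f p → to ih₂ (f (from ih₁ p)))
                           (λ f p → from ih₂ (f (to ih₁ p)))
  where ih₁ = eval-cong e φ
        ih₂ = eval-cong e ψ

module FromCLPreferential {ATM : Set a} (N : CLPreferentialModel ATM ℓ) where
  open CLPreferentialModel N

  -- The loop-cumulative model whose states are the worlds of N, with l w the
  -- set of worlds accessible from w.
  model : LoopCumulativeModel ATM ℓ
  model = record
    { S          = W
    ; W          = W
    ; l          = R
    ; l-nonEmpty = R-serial
    ; _<_        = _<_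
    ; <-irrefl   = <-irrefl
    ; <-trans    = <-trans
    ; V          = V
    ; smooth     = smooth
    }

  -- The two sides unfold to the same type once the conditional is a
  -- constructor, so only the case distinction is needed.
  conditional⇔ : ∀ w C → ConditionalAt w C ⇔ LoopCumulativeModel.ConditionalAt model w C
  conditional⇔ w (A |~ B) = mk⇔ id id

module FromLoopCumulative {ATM : Set a} (M : LoopCumulativeModel ATM ℓ) where
  open LoopCumulativeModel M

  -- A state together with a world in its label. The membership proof is part
  -- of the pair; pairs that differ only in it behave alike.
  Pair : Set ℓ
  Pair = ∃[ s ] ∃[ w ] w ∈ l s

  infix 4 _≺_ _⊨L_

  _≺_ : Rel Pair ℓ
  x ≺ y = proj₁ x < proj₁ y

  SameState : Rel Pair ℓ
  SameState x y = proj₁ x ≡ proj₁ y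

  world : Pair → W
  world (_ , w , _) = w

  pairAt : S → Pair
  pairAt s = s , l-nonEmpty s

  -- Truth of LA at a pair, for accessibility SameState.
  _⊨L_ : Pair → Formula ATM → Set ℓ
  x ⊨L A = ∀ y → SameState x y → world y ⊨ A

  labelling-⊨L : ∀ A x → x ⊨L A ⇔ proj₁ x ∣≡ A
  labelling-⊨L A (s , _) =
    mk⇔ (λ h w w∈ls → h (s , w , w∈ls) refl)
        (λ { h (_ , w , w∈ls) refl → h w w∈ls })

  Min-pair⇔ : ∀ A x → x ∈ Min _≺_ (_⊨L A) ⇔ proj₁ x ∈ Min _<_ (_∣≡ A)
  Min-pair⇔ A x =
    mk⇔ (λ (h , min) → to (labelling-⊨L A x) h ,
           -- Non-emptiness of labels: a smaller state yields a smaller pair.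
           λ s s<x hs → min (pairAt s) s<x (from (labelling-⊨L A (pairAt s)) hs))
        (λ (h , min) → from (labelling-⊨L A x) h ,
           λ y y≺x hy → min (proj₁ y) y≺x (to (labelling-⊨L A y) hy))

  ≺-smooth : ∀ A → Smooth _≺_ (_⊨L A)
  ≺-smooth A x h with smooth A (proj₁ x) (to (labelling-⊨L A x) h)
  ... | inj₁ min             = inj₁ (from (Min-pair⇔ A x) min)
  ... | inj₂ (s , min , s<x) = inj₂ (pairAt s , from (Min-pair⇔ A (pairAt s)) min , s<x)

  -- The CL-preferential model on pairs. A model must have a world, so a state
  -- is required: M itself may have none.
  model : S → CLPreferentialModel ATM ℓ
  model s = record
    { W          = Pair
    ; W-nonEmpty = pairAt s
    ; R          = SameState
    ; R-serial   = λ x → x , refl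
    ; _<_        = _≺_
    ; <-irrefl   = λ x≡y → <-irrefl (cong proj₁ x≡y)
    ; <-trans    = <-trans
    ; V          = λ x → V (world x)
    ; smooth     = ≺-smooth
    }

  conditional⇔ : ∀ s C → ConditionalAt s C ⇔
                 CLPreferentialModel.ConditionalAt (model s) (pairAt s) C
  conditional⇔ s (A |~ B) =
    mk⇔ (λ h x min → from (labelling-⊨L B x) (h (proj₁ x) (to (Min-pair⇔ A x) min)))
        (λ h t min → to (labelling-⊨L B (pairAt t))
                        (h (pairAt t) (from (Min-pair⇔ A (pairAt t)) min)))

proposition2p9 : ∀ {a : Level} (ℓ : Level) (ATM : Set a) (φ : BooleanCombination (Conditional ATM)) →
    LoopCumulativeSatisfiable ℓ φ ⇔ CLPreferentialSatisfiable ℓ φ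
proposition2p9 ℓ ATM φ = mk⇔
  (λ (M , s , h) → let open FromLoopCumulative M in
     model s , pairAt s , to (eval-cong (conditional⇔ s) φ) h)
  (λ (N , w , h) → let open FromCLPreferential N in
     model , w , to (eval-cong (conditional⇔ w) φ) h)
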